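{- Let $f:\subseteq\mathbf U\rightrightarrows\mathbf V$ and $g:\subseteq\mathbf X\rightrightarrows\mathbf Y$ be multi-valued functions on represented spaces. Then $$(g\rightarrow f)\equiv_{\mathrm W}\min_{\leq_{\mathrm W}}\{h : f\leq_{\mathrm W}g\star h\},$$ where $h$ ranges over all multi-valued functions on represented spaces together with the top element $\infty$ (so the set always contains $\infty$). That is, the minimum exists and $(g\rightarrow f)$ is Weihrauch equivalent to it.
   Context: A represented space $\mathbf X=(X,\delta_X)$ is a set $X$ with a partial surjection $\delta_X:\subseteq\mathbb N^{\mathbb N}\to X$ (the symbol $\subseteq$ marks possibly partial functions). A multi-valued function $f:\subseteq\mathbf X\rightrightarrows\mathbf Y$ assigns to each $x\in\mathrm{dom}(f)\subseteq X$ a nonempty set $f(x)\subseteq Y$. Composition: $z\in(f\circ g)(x)$ iff $g(x)\subseteq\mathrm{dom}(f)$ and $z\in f(y)$ for some $y\in g(x)$ (with $x\in\mathrm{dom}(g)$). A function $F:\subseteq\mathbb N^{\mathbb N}\to\mathbb N^{\mathbb N}$ is a realizer of $f$, written $F\vdash f$, if $\delta_YF(p)\in f\delta_X(p)$ for all $p\in\mathrm{dom}(f\delta_X)$. $f\leq_{\mathrm W}g$ iff there are computable $K,H:\subseteq\mathbb N^{\mathbb N}\to\mathbb N^{\mathbb N}$ such that $K\langle\mathrm{id},GH\rangle\vdash f$ for all $G\vdash g$; $\equiv_{\mathrm W}$ is the induced equivalence. Products $\mathbf X\times\mathbf Y$ are represented via pairing $\langle\cdot,\cdot\rangle$, and $(f\times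 g)(x,u)=f(x)\times g(u)$. The preorder $\leq_{\mathrm W}$ is extended by an additional top element $\infty$ (the Axiom of Choice for Baire space is assumed). Space $\mathcal M(\mathbf X,\mathbf Y)$: fix a universal Turing machine; $\Phi_p:\subseteq\mathbb N^{\mathbb N}\to\mathbb N^{\mathbb N}$ is defined by $\Phi_p(q)=r$ iff on input $\langle p,q\rangle$ the machine writes infinitely often on the output tape, producing $r$. Let $\delta_X^{\mathrm{cyl}}\langle p,q\rangle:=\delta_X(p)$ and $\Phi_p^{\mathbf X,\mathbf Y}:=\delta_Y\circ\Phi_p\circ(\delta_X^{\mathrm{cyl}})^{ -1}:\subseteq\mathbf X\rightrightarrows\mathbf Y$. $\mathcal M(\mathbf X,\mathbf Y)$ is the represented space of all $\Phi_p^{\mathbf X,\mathbf Y}$ (strongly continuous multi-valued functions), $p$ being a name of $\Phi_p^{\mathbf X,\mathbf Y}$. Compositional product: for $g:\subseteq\mathbf X\rightrightarrows\mathbf Y$ and a represented space $\mathbf Z$ let $g^{\mathrm t}_{\mathbf Z}:\subseteq\mathcal M(\mathbf Y,\mathbf Z)\times\mathbf X\rightrightarrows\mathbf Z$, $g^{\mathrm t}_{\mathbf Z}(k,x):=(k\circ g)(x)$; for $f:\subseteq\mathbf U\rightrightarrows\mathbf V$ put $f\star g:=(\mathrm{id}_{\mathbb N^{\mathbb N}}\times f)\circ g^{\mathrm t}_{\mathbb N^{\mathbb N}\times\mathbf U}$. Moreover $f\star\infty=\infty\star f=\infty$. Implication: for $f:\subseteq\mathbf U\rightrightarrows\mathbf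 V$ and $g:\subseteq\mathbf X\rightrightarrows\mathbf Y$ with $\mathrm{dom}(g)\neq\emptyset$ or $\mathrm{dom}(f)=\emptyset$, $(g\rightarrow f):\subseteq\mathbf U\rightrightarrows\mathcal M(\mathbf Y,\mathbf V)\times\mathbf X$ has $\mathrm{dom}(g\rightarrow f)=\mathrm{dom}(f)$, and $(H,x)\in(g\rightarrow f)(u)$ iff $(H\circ g)(x)\subseteq f(u)$ (where $x\in\mathrm{dom}(H\circ g)$). If $\mathrm{dom}(g)=\emptyset$ and $\mathrm{dom}(f)\neq\emptyset$, then $(g\rightarrow f):=\infty$. -}

module Defs where

open import Axiom.ExcludedMiddle using (ExcludedMiddle)
open import Data.Empty.Polymorphic using (⊥)
open import Data.Fin using (Fin)
open import Data.Nat using (ℕ; zero; suc)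
open import Data.Product using (∃-syntax; Σ-syntax; _×_; _,_)
open import Data.Product.Relation.Binary.Pointwise.NonDependent using (_×ₛ_)
open import Data.Sum using (_⊎_)
open import Data.Unit.Polymorphic using (⊤)
open import Data.Vec using (Vec; []; _∷_; lookup)
open import Data.Vec.Relation.Binary.Pointwise.Inductive using (Pointwise; []; _∷_)
open import Function using (_∘′_; case_of_)
open import Function.Bundles using (_⇔_; mk⇔; Equivalence)
open import Level using (0ℓ)
open import Relation.Binary.Bundles using (Setoid)
open import Relation.Binary.PropositionalEquality
  using (_≗_; refl; sym; trans; subst; _→-setoid_)
open import Relation.Nullary using (¬_; yes; no)

open Setoid using (Carrier)

Baire : Set
Baire = ℕ → ℕ

𝔹 : Setoid 0ℓ 0ℓ
𝔹 = ℕ →-setoid ℕ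

-- Interleaving: ⟨ p , q ⟩ (2n) = p n and ⟨ p , q ⟩ (2n+1) = q n.

⟨_,_⟩ : Baire → Baire → Baire
⟨ p , q ⟩ zero    = p zero
⟨ p , q ⟩ (suc n) = ⟨ q , p ∘′ suc ⟩ n

⟨⟩-cong : ∀ {p p′ q q′} → p ≗ p′ → q ≗ q′ → ⟨ p , q ⟩ ≗ ⟨ p′ , q′ ⟩
⟨⟩-cong e d zero    = e zero
⟨⟩-cong e d (suc n) = ⟨⟩-cong d (λ k → e (suc k)) n

⟨⟩-injectiveʳ : ∀ p p′ q q′ → ⟨ p , q ⟩ ≗ ⟨ p′ , q′ ⟩ → q ≗ q′
⟨⟩-injectiveʳ p p′ q q′ e zero    = e 1
⟨⟩-injectiveʳ p p′ q q′ e (suc n) =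
  ⟨⟩-injectiveʳ (p ∘′ suc) (p′ ∘′ suc) (q ∘′ suc) (q′ ∘′ suc)
                (λ k → e (suc (suc k))) n

⟨⟩-injectiveˡ : ∀ p p′ q q′ → ⟨ p , q ⟩ ≗ ⟨ p′ , q′ ⟩ → p ≗ p′
⟨⟩-injectiveˡ p p′ q q′ e zero    = e zero
⟨⟩-injectiveˡ p p′ q q′ e (suc n) =
  ⟨⟩-injectiveʳ q q′ (p ∘′ suc) (p′ ∘′ suc) (λ k → e (suc k)) n

-- A partial multi-valued function is given by its graph; its domain is
-- the set of points with at least one value, so that values on the
-- domain are automatically nonempty sets.

infix 3 _⇉_

record _⇉_ (X Y : Setoid 0ℓ 0ℓ) : Set₁ where
  open Setoid X using () renaming (_≈_ to _≈₁_)
  open Setoid Y using () renaming (_≈_ to _≈₂_)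
  field
    graph : Carrier X → Carrier Y → Set
    resp  : ∀ {x x′ y y′} → x ≈₁ x′ → y ≈₂ y′ → graph x y → graph x′ y′

open _⇉_ public

private
  variable
    S T R Q : Setoid 0ℓ 0ℓ

infix 4 _∈dom_ _≐_

_∈dom_ : Carrier S → (S ⇉ T) → Set
x ∈dom f = ∃[ y ] graph f x y

_≐_ : (f g : S ⇉ T) → Set
f ≐ g = ∀ x y → graph f x y ⇔ graph g x y

SingleValued : (S ⇉ T) → Set
SingleValued {T = T} f =
  ∀ {x y y′} → graph f x y → graph f x y′ → Setoid._≈_ T y y′

∈dom-resp : (f : S ⇉ T) {x x′ : Carrier S} →
            Setoid._≈_ S x x′ → x ∈dom f → x′ ∈dom f
∈dom-resp {T = T} f e (y , fxy) = y , resp f e (Setoid.refl T) fxy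

idₘ : S ⇉ S
idₘ {S} = record
  { graph = Setoid._≈_ S
  ; resp  = λ e d x≈y → S.trans (S.sym e) (S.trans x≈y d)
  } where module S = Setoid S

infixr 9 _∘_

_∘_ : (T ⇉ R) → (S ⇉ T) → (S ⇉ R)
_∘_ {T} {R} {S} f g = record
  { graph = λ x z → (∀ y → graph g x y → y ∈dom f)
                  × (∃[ y ] (graph g x y × graph f y z))
  ; resp  = λ { e d (total , y , gxy , fyz) →
      (λ y′ gx′y′ → total y′ (resp g (S.sym e) T.refl gx′y′))
      , y , resp g e T.refl gxy , resp f T.refl d fyz }
  }
  where
  module S = Setoid S
  module T = Setoid T

infix 10 _⁻¹

_⁻¹ : (S ⇉ T) → (T ⇉ S)
f ⁻¹ = record
  { graph = λ y x → graph f x y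
  ; resp  = λ e d → resp f d e
  }

infixr 8 _⊗_

_⊗_ : (S ⇉ T) → (R ⇉ Q) → (S ×ₛ R ⇉ T ×ₛ Q)
f ⊗ g = record
  { graph = λ { (x , u) (y , v) → graph f x y × graph g u v }
  ; resp  = λ { (e , e′) (d , d′) (fxy , guv) →
                resp f e d fxy , resp g e′ d′ guv }
  }

⟪_,_⟫ : (F G : 𝔹 ⇉ 𝔹) → (𝔹 ⇉ 𝔹)
⟪ F , G ⟫ = record
  { graph = λ p r → ∃[ a ] ∃[ b ] (graph F p a × graph G p b × r ≗ ⟨ a , b ⟩)
  ; resp  = λ { e d (a , b , Fpa , Gpb , r≗) →
      a , b , resp F e (λ _ → refl) Fpa , resp G e (λ _ → refl) Gpb
      , λ n → trans (sym (d n)) (r≗ n) }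
  }

-- Syntax for the n-ary functions that are partial recursive relative
-- to an oracle p ∈ Baire, the infinite input of the machine.

data Program : ℕ → Set where
  zer    : Program 0
  succ   : Program 1
  proj   : ∀ {n} → Fin n → Program n
  oracle : Program 1
  comp   : ∀ {m n} → Program m → Vec (Program n) m → Program n
  prec   : ∀ {n} → Program n → Program (suc (suc n)) → Program (suc n)
  mu     : ∀ {n} → Program (suc n) → Program n

mutual
  infix 3 _⊢_[_]⇓_ _⊢_[_]from_⇓_

  data _⊢_[_]⇓_ (p : Baire) : ∀ {n} → Program n → Vec ℕ n → ℕ → Set where
    ⇓zer    : p ⊢ zer [ [] ]⇓ 0
    ⇓succ   : ∀ {x} → p ⊢ succ [ x ∷ [] ]⇓ suc x
    ⇓proj   : ∀ {n} {i : Fin n} {xs} → p ⊢ proj i [ xs ]⇓ lookup xs i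
    ⇓oracle : ∀ {x} → p ⊢ oracle [ x ∷ [] ]⇓ p x
    ⇓comp   : ∀ {m n} {c : Program m} {cs : Vec (Program n) m} {xs ys z} →
              Pointwise (λ c′ y → p ⊢ c′ [ xs ]⇓ y) cs ys →
              p ⊢ c [ ys ]⇓ z → p ⊢ comp c cs [ xs ]⇓ z
    ⇓prec0  : ∀ {n} {c : Program n} {d xs z} →
              p ⊢ c [ xs ]⇓ z → p ⊢ prec c d [ 0 ∷ xs ]⇓ z
    ⇓precS  : ∀ {n} {c : Program n} {d k xs y z} →
              p ⊢ prec c d [ k ∷ xs ]⇓ y → p ⊢ d [ k ∷ y ∷ xs ]⇓ z →
              p ⊢ prec c d [ suc k ∷ xs ]⇓ z
    ⇓mu     : ∀ {n} {c : Program (suc n)} {xs m} →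
              p ⊢ c [ xs ]from 0 ⇓ m → p ⊢ mu c [ xs ]⇓ m

  -- Search, starting at k, for the first m with c (m ∷ xs) = 0.

  data _⊢_[_]from_⇓_ (p : Baire) {n} (c : Program (suc n)) (xs : Vec ℕ n)
                     : ℕ → ℕ → Set where
    found : ∀ {k} → p ⊢ c [ k ∷ xs ]⇓ 0 → p ⊢ c [ xs ]from k ⇓ k
    next  : ∀ {k v m} → p ⊢ c [ k ∷ xs ]⇓ suc v →
            p ⊢ c [ xs ]from suc k ⇓ m → p ⊢ c [ xs ]from k ⇓ m

mutual
  ⇓-resp : ∀ {p q n} {c : Program n} {xs z} → p ≗ q →
           p ⊢ c [ xs ]⇓ z → q ⊢ c [ xs ]⇓ z
  ⇓-resp e ⇓zer              = ⇓zer
  ⇓-resp e ⇓succ             = ⇓succ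
  ⇓-resp e ⇓proj             = ⇓proj
  ⇓-resp {q = q} e (⇓oracle {x}) =
    subst (λ z → q ⊢ oracle [ x ∷ [] ]⇓ z) (sym (e x)) ⇓oracle
  ⇓-resp e (⇓comp ds d)      = ⇓comp (⇓s-resp e ds) (⇓-resp e d)
  ⇓-resp e (⇓prec0 d)        = ⇓prec0 (⇓-resp e d)
  ⇓-resp e (⇓precS d d′)     = ⇓precS (⇓-resp e d) (⇓-resp e d′)
  ⇓-resp e (⇓mu s)           = ⇓mu (from-resp e s)

  ⇓s-resp : ∀ {p q m n} {cs : Vec (Program n) m} {xs ys} → p ≗ q →
            Pointwise (λ c y → p ⊢ c [ xs ]⇓ y) cs ys →
            Pointwise (λ c y → q ⊢ c [ xs ]⇓ y) cs ys
  ⇓s-resp e []       = []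
  ⇓s-resp e (d ∷ ds) = ⇓-resp e d ∷ ⇓s-resp e ds

  from-resp : ∀ {p q n} {c : Program (suc n)} {xs k m} → p ≗ q →
              p ⊢ c [ xs ]from k ⇓ m → q ⊢ c [ xs ]from k ⇓ m
  from-resp e (found d)  = found (⇓-resp e d)
  from-resp e (next d s) = next (⇓-resp e d) (from-resp e s)

Machine : Set
Machine = Program 1

-- On input p the machine produces the infinite output r when it yields
-- every digit r n; p lies outside the domain as soon as one digit of
-- the output is missing.

⟦_⟧ : Machine → (𝔹 ⇉ 𝔹)
⟦ c ⟧ = record
  { graph = λ p r → ∀ n → p ⊢ c [ n ∷ [] ]⇓ r n
  ; resp  = λ {p} {p′} e d run n →
      subst (λ z → p′ ⊢ c [ n ∷ [] ]⇓ z) (d n) (⇓-resp e (run n))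
  }

-- A partial function is computable if some machine computes it on its
-- domain.  Since machines are deterministic, such an F is single-valued.

Computable : (𝔹 ⇉ 𝔹) → Set
Computable F = ∃[ c ] (∀ p r → graph F p r → graph ⟦ c ⟧ p r)

-- Universality in the sense required to name functions with parameters:
-- each machine M, run with parameter p, is simulated by 𝒰 run with a
-- parameter p′ that is computable from p (p′ encodes M together with p).

Universal : Machine → Set
Universal 𝒰 = ∀ (M : Machine) → ∃[ s ] (∀ p → ∃[ p′ ] (graph ⟦ s ⟧ p p′
  × (∀ q r → graph ⟦ 𝒰 ⟧ ⟨ p′ , q ⟩ r ⇔ graph ⟦ M ⟧ ⟨ p , q ⟩ r)))

record RepSpace : Set₁ where
  field
    Point    : Setoid 0ℓ 0ℓ
    δ        : 𝔹 ⇉ Point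
    δ-single : SingleValued δ
    δ-onto   : ∀ x → x ∈dom δ ⁻¹

open RepSpace public

𝔹ʳ : RepSpace
𝔹ʳ = record
  { Point    = 𝔹
  ; δ        = idₘ
  ; δ-single = λ e d n → trans (sym (e n)) (d n)
  ; δ-onto   = λ p → p , λ _ → refl
  }

infixr 2 _×ʳ_

_×ʳ_ : RepSpace → RepSpace → RepSpace
X ×ʳ Y = record
  { Point    = Point X ×ₛ Point Y
  ; δ        = record
      { graph = λ { r (x , y) →
          ∃[ p ] ∃[ q ] (r ≗ ⟨ p , q ⟩ × graph (δ X) p x × graph (δ Y) q y) }
      ; resp  = λ { e (d , d′) (p , q , r≗ , px , qy) →
          p , q , (λ n → trans (sym (e n)) (r≗ n))
          , resp (δ X) (λ _ → refl) d px , resp (δ Y) (λ _ → refl) d′ qy }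
      }
  ; δ-single = λ { (p , q , r≗ , px , qy) (p′ , q′ , r≗′ , px′ , qy′) →
      let e : ⟨ p′ , q′ ⟩ ≗ ⟨ p , q ⟩
          e n = trans (sym (r≗′ n)) (r≗ n)
      in
        δ-single X px (resp (δ X) (⟨⟩-injectiveˡ p′ p q′ q e) (Setoid.refl (Point X)) px′)
      , δ-single Y qy (resp (δ Y) (⟨⟩-injectiveʳ p′ p q′ q e) (Setoid.refl (Point Y)) qy′) }
  ; δ-onto   = λ { (x , y) →
      let (p , px) = δ-onto X x
          (q , qy) = δ-onto Y y
      in ⟨ p , q ⟩ , p , q , (λ _ → refl) , px , qy }
  }

δcyl : (X : RepSpace) → 𝔹 ⇉ Point X
δcyl X = record
  { graph = λ r x → ∃[ p ] ∃[ q ] (r ≗ ⟨ p , q ⟩ × graph (δ X) p x)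
  ; resp  = λ { e d (p , q , r≗ , px) →
      p , q , (λ n → trans (sym (e n)) (r≗ n)) , resp (δ X) (λ _ → refl) d px }
  }

private
  variable
    X Y : RepSpace

-- Partial functions are the single-valued F : S ⇉ T, so realizers are
-- required to be single-valued.

Realizes : (X Y : RepSpace) → (𝔹 ⇉ 𝔹) → (Point X ⇉ Point Y) → Set
Realizes X Y F f = SingleValued F ×
  (∀ p → p ∈dom (f ∘ δ X) → ∃[ y ] (graph (δ Y ∘ F) p y × graph (f ∘ δ X) p y))

data Problem : Set₁ where
  prob : (X Y : RepSpace) → (Point X ⇉ Point Y) → Problem
  ∞    : Problem

infix 4 _≤W_ _≡W_

_≤W_ : Problem → Problem → Set₁
_          ≤W ∞          = ⊤
∞          ≤W prob _ _ _ = ⊥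
prob U V f ≤W prob X Y g = ∃[ K ] ∃[ H ] (Computable K × Computable H ×
  (∀ G → Realizes X Y G g → Realizes U V (K ∘ ⟪ idₘ , G ∘ H ⟫) f))

_≡W_ : Problem → Problem → Set₁
f ≡W g = f ≤W g × g ≤W f

IsMinimum : (Problem → Set₁) → Problem → Set₁
IsMinimum P m = P m × (∀ h → P h → m ≤W h)

-- The axiom of choice for Baire space: every partial multi-valued
-- function on Baire space has a single-valued selector.

ChoiceBaire : Set₁
ChoiceBaire = (A : 𝔹 ⇉ 𝔹) → Σ[ F ∈ 𝔹 ⇉ 𝔹 ] (SingleValued F ×
  (∀ p → p ∈dom A → ∃[ q ] (graph F p q × graph A p q)))

module _ (𝒰 : Machine) where

  Φ : Baire → (𝔹 ⇉ 𝔹)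
  Φ p = record
    { graph = λ q r → graph ⟦ 𝒰 ⟧ ⟨ p , q ⟩ r
    ; resp  = λ e → resp ⟦ 𝒰 ⟧ (⟨⟩-cong {p} (λ _ → refl) e)
    }

  Φʳ : (X Y : RepSpace) → Baire → (Point X ⇉ Point Y)
  Φʳ X Y p = δ Y ∘ Φ p ∘ δcyl X ⁻¹

  Φ-cong : ∀ {p p′} → p ≗ p′ → ∀ q r → graph (Φ p) q r → graph (Φ p′) q r
  Φ-cong e q r = resp ⟦ 𝒰 ⟧ (⟨⟩-cong {q = q} e (λ _ → refl)) (λ _ → refl)

  Φʳ-mono : ∀ {p p′} → p ≗ p′ → ∀ x y →
            graph (Φʳ X Y p) x y → graph (Φʳ X Y p′) x y
  Φʳ-mono e x y (total , r , (total′ , q , qx , pqr) , ry) =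
      (λ { r′ (_ , q′ , q′x , p′q′r′) →
           total r′ (total′ , q′ , q′x , Φ-cong (λ n → sym (e n)) q′ r′ p′q′r′) })
    , r
    , ( (λ q′ q′x → let (s , pq′s) = total′ q′ q′x in s , Φ-cong e q′ s pq′s)
      , q , qx , Φ-cong e q r pqr )
    , ry

  -- The space of the multi-valued functions Φʳ X Y p.  The set
  -- { Φʳ X Y p | p ∈ Baire } is the quotient of Baire by the kernel of
  -- p ↦ Φʳ X Y p: a point is given by some p, and two points are equal
  -- when they are the same multi-valued function.

  𝓜 : RepSpace → RepSpace → RepSpace
  𝓜 X Y = record
    { Point    = MS
    ; δ        = record
        { graph = λ p k → Φʳ X Y p ≐ Φʳ X Y k
        ; resp  = λ e d p≐k → MS.trans (MS.sym (≗⇒≐ e)) (MS.trans p≐k d)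
        }
    ; δ-single = λ p≐k p≐k′ → MS.trans (MS.sym p≐k) p≐k′
    ; δ-onto   = λ k → k , MS.refl
    }
    where
    MS : Setoid 0ℓ 0ℓ
    MS = record
      { Carrier       = Baire
      ; _≈_           = λ p p′ → Φʳ X Y p ≐ Φʳ X Y p′
      ; isEquivalence = record
          { refl  = λ x y → mk⇔ (λ z → z) (λ z → z)
          ; sym   = λ e x y → mk⇔ (Equivalence.from (e x y)) (Equivalence.to (e x y))
          ; trans = λ e d x y →
              mk⇔ (Equivalence.to (d x y) ∘′ Equivalence.to (e x y))
                  (Equivalence.from (e x y) ∘′ Equivalence.from (d x y))
          }
      }
    module MS = Setoid MS

    ≗⇒≐ : ∀ {p p′} → p ≗ p′ → Φʳ X Y p ≐ Φʳ X Y p′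
    ≗⇒≐ e x y = mk⇔ (Φʳ-mono {X} {Y} e x y)
                     (Φʳ-mono {X} {Y} (λ n → sym (e n)) x y)

  ∘-cong : {k k′ : T ⇉ R} (g : S ⇉ T) → k ≐ k′ →
           ∀ x z → graph (k ∘ g) x z → graph (k′ ∘ g) x z
  ∘-cong g e x z (total , y , gxy , kyz) =
      (λ y′ gxy′ → let (w , ky′w) = total y′ gxy′ in w , Equivalence.to (e y′ w) ky′w)
    , y , gxy , Equivalence.to (e y z) kyz

  transpose : (X Y Z : RepSpace) → (Point X ⇉ Point Y) →
              (Point (𝓜 Y Z ×ʳ X) ⇉ Point Z)
  transpose X Y Z g = record
    { graph = λ { (k , x) z → graph (Φʳ Y Z k ∘ g) x z }
    ; resp  = λ { {k , x} {k′ , x′} {z} {z′} (e , d) z≈ kgxz →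
        resp (Φʳ Y Z k′ ∘ g) d z≈
          (∘-cong {k = Φʳ Y Z k} {k′ = Φʳ Y Z k′} g e x z kgxz) }
    }

  infixr 7 _⋆_

  _⋆_ : Problem → Problem → Problem
  prob U V f ⋆ prob X Y g =
    prob (𝓜 Y (𝔹ʳ ×ʳ U) ×ʳ X) (𝔹ʳ ×ʳ V)
         ((idₘ {S = 𝔹} ⊗ f) ∘ transpose X Y (𝔹ʳ ×ʳ U) g)
  prob _ _ _ ⋆ ∞          = ∞
  ∞          ⋆ _          = ∞

  -- g → f when dom g ≠ ∅ or dom f = ∅.  Every u ∈ dom f then has a value,
  -- e.g. a constant H and any x ∈ dom g, so the domain is dom f.

  implies : (X Y U V : RepSpace) → (Point X ⇉ Point Y) → (Point U ⇉ Point V) →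
            (Point U ⇉ Point (𝓜 Y V ×ʳ X))
  implies X Y U V g f = record
    { graph = λ { u (H , x) → u ∈dom f × x ∈dom (Φʳ Y V H ∘ g)
                × (∀ v → graph (Φʳ Y V H ∘ g) x v → graph f u v) }
    ; resp  = λ { {u} {u′} {H , x} {H′ , x′} u≈ (e , d) (u∈ , (w , Hgxw) , sub) →
          ∈dom-resp f u≈ u∈
        , ∈dom-resp (Φʳ Y V H′ ∘ g) d
            (w , ∘-cong {k = Φʳ Y V H} {k′ = Φʳ Y V H′} g e x w Hgxw)
        , λ v H′gx′v → resp f u≈ (Setoid.refl (Point V)) (sub v
            (∘-cong {k = Φʳ Y V H′} {k′ = Φʳ Y V H} g (Setoid.sym (Point (𝓜 Y V)) {H} {H′} e) x v
              (resp (Φʳ Y V H′ ∘ g) (Setoid.sym (Point X) d) (Setoid.refl (Point V)) H′gx′v))) }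
    }

  -- Excluded middle decides which of the two cases of the definition applies.

  implication : ExcludedMiddle 0ℓ → (X Y U V : RepSpace) →
                (Point X ⇉ Point Y) → (Point U ⇉ Point V) → Problem
  implication em X Y U V g f =
    case em {P = (∃[ x ] (x ∈dom g)) ⊎ (∀ u → ¬ (u ∈dom f))} of λ where
      (yes _) → prob U (𝓜 Y V ×ʳ X) (implies X Y U V g f)
      (no  _) → ∞

{-# OPTIONS --safe #-}
module Submission where

-- Why the theorem holds.  Write A ⊑ B when there are machines K and H such
-- that for each name p of an instance of A the machine H computes from p a
-- name q of an instance of B, and K computes from ⟨ p , b ⟩ a solution of p
-- whenever b is a solution of q.  This is Reduction below.  With choice and
-- excluded middle it is the same as ≤W (reduction⇒≤W, ≤W⇒reduction): a
-- realizer of B may be chosen undefined off the instances of B, which forces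
-- q to be an instance, and it may be chosen to take any prescribed solution b
-- as its value at q, which forces K to work for every b.
--
-- Suppose first that dom g ≠ ∅ or dom f = ∅.
--
-- The implication belongs to the set (implication-member).  From a name of
-- u, the implication gives some (H , x), and a fixed function of 𝓜 turns a
-- name ⟨ a , b ⟩ of (H , x) into the pair of a and x.  So g ⋆ (g → f)
-- returns a name a of H together with some y ∈ g x, and the universal
-- machine applied to a and to a name of y finds an element of f u.
--
-- The implication is a lower bound (implication-lower).  Let K and H witness
-- f ⊑ g ⋆ h, and let p be a name of u.  Then H p = ⟨ k , a ⟩, where a names
-- an instance of h.  Given a solution b of a, running k on b yields r and a
-- name of some x ∈ dom g.  For every y ∈ g x the pair (r , y) is a
-- solution of H p, so that q ↦ K ⟨ p , ⟨ r , q ⟩ ⟩ takes each name of y to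
-- a name of an element of f u.  An index of this function can be computed from
-- p and r by universality, and together with x it solves (g → f) at u.
--
-- If dom g = ∅ and dom f ≠ ∅, then g ⋆ h has empty domain for every h ≠ ∞,
-- so that ∞ is the only member of the set (⋆-instance).

open import Defs
open import Axiom.ExcludedMiddle using (ExcludedMiddle)
open import Data.Fin.Patterns using (0F; 1F; 3F)
open import Data.Nat using (ℕ; zero; suc)
open import Data.Product using (∃-syntax; Σ-syntax; _×_; _,_; proj₁; proj₂)
open import Data.Sum using (_⊎_; inj₁; inj₂; [_,_]′)
open import Data.Unit.Polymorphic using (tt)
open import Data.Vec using (Vec; []; _∷_)
open import Data.Vec.Relation.Binary.Pointwise.Inductive using (Pointwise; []; _∷_)
open import Function.Bundles using (Equivalence)
open import Level using (0ℓ)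
open import Relation.Binary.Bundles using (Setoid)
open import Relation.Binary.PropositionalEquality
  using (_≡_; _≗_; refl; sym; trans; subst)
open import Relation.Nullary using (¬_; yes; no; contradiction)

open Setoid using (Carrier)

-- Determinism of machines

mutual
  ⇓-det : ∀ {p n} {c : Program n} {xs y z} →
          p ⊢ c [ xs ]⇓ y → p ⊢ c [ xs ]⇓ z → y ≡ z
  ⇓-det ⇓zer ⇓zer = refl
  ⇓-det ⇓succ ⇓succ = refl
  ⇓-det ⇓proj ⇓proj = refl
  ⇓-det ⇓oracle ⇓oracle = refl
  ⇓-det (⇓comp ds d) (⇓comp es e) with ⇓s-det ds es
  ... | refl = ⇓-det d e
  ⇓-det (⇓prec0 d) (⇓prec0 e) = ⇓-det d e
  ⇓-det (⇓precS d d′) (⇓precS e e′) with ⇓-det d e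
  ... | refl = ⇓-det d′ e′
  ⇓-det (⇓mu s) (⇓mu t) = from-det s t

  ⇓s-det : ∀ {p m n} {cs : Vec (Program n) m} {xs ys zs} →
           Pointwise (λ c y → p ⊢ c [ xs ]⇓ y) cs ys →
           Pointwise (λ c z → p ⊢ c [ xs ]⇓ z) cs zs → ys ≡ zs
  ⇓s-det [] [] = refl
  ⇓s-det (d ∷ ds) (e ∷ es) with ⇓-det d e | ⇓s-det ds es
  ... | refl | refl = refl

  from-det : ∀ {p n} {c : Program (suc n)} {xs k y z} →
             p ⊢ c [ xs ]from k ⇓ y → p ⊢ c [ xs ]from k ⇓ z → y ≡ z
  from-det (found d) (found e) = refl
  from-det (found d) (next e t) with ⇓-det d e
  ... | ()
  from-det (next d s) (found e) with ⇓-det d e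
  ... | ()
  from-det (next d s) (next e t) = from-det s t

⟦⟧-det : ∀ M {p p′ q q′} → p ≗ p′ →
         graph ⟦ M ⟧ p q → graph ⟦ M ⟧ p′ q′ → q ≗ q′
⟦⟧-det M e run run′ n = ⇓-det (⇓-resp e (run n)) (run′ n)

⟦⟧-resp : ∀ M {p p′ q} → p ≗ p′ → graph ⟦ M ⟧ p q → graph ⟦ M ⟧ p′ q
⟦⟧-resp M e = resp ⟦ M ⟧ e (λ _ → refl)

-- Composing and pairing machines

-- The program c [ M ] replaces each oracle call in c by a run of M; on
-- machines this is composition.

mutual
  infix 20 _[_] _[_]s

  _[_] : ∀ {n} → Program n → Machine → Program n
  zer       [ M ] = zer
  succ      [ M ] = succ
  proj i    [ M ] = proj i
  oracle    [ M ] = M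
  comp c cs [ M ] = comp (c [ M ]) (cs [ M ]s)
  prec c d  [ M ] = prec (c [ M ]) (d [ M ])
  mu c      [ M ] = mu (c [ M ])

  _[_]s : ∀ {m n} → Vec (Program n) m → Machine → Vec (Program n) m
  []       [ M ]s = []
  (c ∷ cs) [ M ]s = c [ M ] ∷ cs [ M ]s

mutual
  []-⇓ : ∀ {p q n M} {c : Program n} {xs z} → graph ⟦ M ⟧ p q →
         q ⊢ c [ xs ]⇓ z → p ⊢ c [ M ] [ xs ]⇓ z
  []-⇓ run ⇓zer          = ⇓zer
  []-⇓ run ⇓succ         = ⇓succ
  []-⇓ run ⇓proj         = ⇓proj
  []-⇓ run ⇓oracle       = run _
  []-⇓ run (⇓comp ds d)  = ⇓comp ([]-⇓s run ds) ([]-⇓ run d)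
  []-⇓ run (⇓prec0 d)    = ⇓prec0 ([]-⇓ run d)
  []-⇓ run (⇓precS d d′) = ⇓precS ([]-⇓ run d) ([]-⇓ run d′)
  []-⇓ run (⇓mu s)       = ⇓mu ([]-from run s)

  []-⇓s : ∀ {p q m n M} {cs : Vec (Program n) m} {xs ys} → graph ⟦ M ⟧ p q →
          Pointwise (λ c y → q ⊢ c [ xs ]⇓ y) cs ys →
          Pointwise (λ c y → p ⊢ c [ xs ]⇓ y) (cs [ M ]s) ys
  []-⇓s run []       = []
  []-⇓s run (d ∷ ds) = []-⇓ run d ∷ []-⇓s run ds

  []-from : ∀ {p q n M} {c : Program (suc n)} {xs k z} → graph ⟦ M ⟧ p q →
            q ⊢ c [ xs ]from k ⇓ z → p ⊢ c [ M ] [ xs ]from k ⇓ z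
  []-from run (found d)  = found ([]-⇓ run d)
  []-from run (next d s) = next ([]-⇓ run d) ([]-from run s)

[]-runs : ∀ N M {p q r} → graph ⟦ M ⟧ p q → graph ⟦ N ⟧ q r → graph ⟦ N [ M ] ⟧ p r
[]-runs N M run run′ n = []-⇓ run (run′ n)

oracle-runs : ∀ p → graph ⟦ oracle ⟧ p p
oracle-runs p n = ⇓oracle

double : ℕ → ℕ
double zero    = zero
double (suc n) = suc (suc (double n))

doubleᴾ : Program 1
doubleᴾ = prec zer (comp succ (comp succ (proj 1F ∷ []) ∷ []))

double-⇓ : ∀ {p} n → p ⊢ doubleᴾ [ n ∷ [] ]⇓ double n
double-⇓ zero    = ⇓prec0 ⇓zer
double-⇓ (suc n) = ⇓precS (double-⇓ n) (⇓comp (⇓comp (⇓proj ∷ []) ⇓succ ∷ []) ⇓succ)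

⟨⟩-even : ∀ p q n → ⟨ p , q ⟩ (double n) ≡ p n
⟨⟩-even p q zero    = refl
⟨⟩-even p q (suc n) = ⟨⟩-even (λ k → p (suc k)) (λ k → q (suc k)) n

⟨⟩-odd : ∀ p q n → ⟨ p , q ⟩ (suc (double n)) ≡ q n
⟨⟩-odd p q zero    = refl
⟨⟩-odd p q (suc n) = ⟨⟩-odd (λ k → p (suc k)) (λ k → q (suc k)) n

-- The two projections of ⟨_,_⟩.

evens odds : Machine
evens = comp oracle (doubleᴾ ∷ [])
odds  = comp oracle (comp succ (doubleᴾ ∷ []) ∷ [])

evens-runs : ∀ p q → graph ⟦ evens ⟧ ⟨ p , q ⟩ p
evens-runs p q n = subst (λ z → ⟨ p , q ⟩ ⊢ evens [ n ∷ [] ]⇓ z) (⟨⟩-even p q n)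
  (⇓comp (double-⇓ n ∷ []) ⇓oracle)

odds-runs : ∀ p q → graph ⟦ odds ⟧ ⟨ p , q ⟩ q
odds-runs p q n = subst (λ z → ⟨ p , q ⟩ ⊢ odds [ n ∷ [] ]⇓ z) (⟨⟩-odd p q n)
  (⇓comp (⇓comp (double-⇓ n ∷ []) ⇓succ ∷ []) ⇓oracle)

ifZero : ℕ → ℕ → ℕ → ℕ
ifZero zero    a b = a
ifZero (suc _) a b = b

ifZeroᴾ : Program 3
ifZeroᴾ = prec (proj 0F) (proj 3F)

ifZero-⇓ : ∀ {p} n {a b} → p ⊢ ifZeroᴾ [ n ∷ a ∷ b ∷ [] ]⇓ ifZero n a b
ifZero-⇓ zero    = ⇓prec0 ⇓proj
ifZero-⇓ (suc n) = ⇓precS (ifZero-⇓ n) ⇓proj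

parity half : ℕ → ℕ
parity zero    = 0
parity (suc n) = ifZero (parity n) 1 0
half zero    = 0
half (suc n) = ifZero (parity n) (half n) (suc (half n))

parityᴾ halfᴾ : Program 1
parityᴾ = prec zer (comp ifZeroᴾ (proj 1F ∷ comp succ (comp zer [] ∷ []) ∷ comp zer [] ∷ []))
halfᴾ   = prec zer (comp ifZeroᴾ
  (comp parityᴾ (proj 0F ∷ []) ∷ proj 1F ∷ comp succ (proj 1F ∷ []) ∷ []))

parity-⇓ : ∀ {p} n → p ⊢ parityᴾ [ n ∷ [] ]⇓ parity n
parity-⇓ zero    = ⇓prec0 ⇓zer
parity-⇓ (suc n) = ⇓precS (parity-⇓ n)
  (⇓comp (⇓proj ∷ ⇓comp (⇓comp [] ⇓zer ∷ []) ⇓succ ∷ ⇓comp [] ⇓zer ∷ [])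
         (ifZero-⇓ (parity n)))

half-⇓ : ∀ {p} n → p ⊢ halfᴾ [ n ∷ [] ]⇓ half n
half-⇓ zero    = ⇓prec0 ⇓zer
half-⇓ (suc n) = ⇓precS (half-⇓ n)
  (⇓comp (⇓comp (⇓proj ∷ []) (parity-⇓ n) ∷ ⇓proj ∷ ⇓comp (⇓proj ∷ []) ⇓succ ∷ [])
         (ifZero-⇓ (parity n)))

⟨⟩-digit : ∀ p q n → ⟨ p , q ⟩ n ≡ ifZero (parity n) (p (half n)) (q (half n))
⟨⟩-digit p q zero    = refl
⟨⟩-digit p q (suc n) with parity n | ⟨⟩-digit q (λ k → p (suc k)) n
... | zero  | ih = ih
... | suc _ | ih = ih

-- Both digits are computed before one of them is selected, which is
-- harmless as M and N are total on the inputs of interest.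

pairing : Machine → Machine → Machine
pairing M N = comp ifZeroᴾ (parityᴾ ∷ comp M (halfᴾ ∷ []) ∷ comp N (halfᴾ ∷ []) ∷ [])

pairing-runs : ∀ M N {p q r} → graph ⟦ M ⟧ p q → graph ⟦ N ⟧ p r →
               graph ⟦ pairing M N ⟧ p ⟨ q , r ⟩
pairing-runs M N {p} {q} {r} run run′ n =
  subst (λ z → p ⊢ pairing M N [ n ∷ [] ]⇓ z) (sym (⟨⟩-digit q r n))
    (⇓comp ( parity-⇓ n
           ∷ ⇓comp (half-⇓ n ∷ []) (run (half n))
           ∷ ⇓comp (half-⇓ n ∷ []) (run′ (half n)) ∷ [])
      (ifZero-⇓ (parity n)))

-- Weihrauch reducibility in terms of names

-- Sol X Y f p q: p is a name of an instance of f, and q is a name of one of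
-- its solutions.

Sol : (X Y : RepSpace) → (Point X ⇉ Point Y) → (𝔹 ⇉ 𝔹)
Sol X Y f = record
  { graph = λ p q → ∃[ x ] ∃[ y ] (graph (δ X) p x × graph f x y × graph (δ Y) q y)
  ; resp  = λ { e d (x , y , px , fxy , qy) →
      x , y , resp (δ X) e (Setoid.refl (Point X)) px , fxy
      , resp (δ Y) d (Setoid.refl (Point Y)) qy }
  }

δ-resp : ∀ X {p p′ x} → p ≗ p′ → graph (δ X) p x → graph (δ X) p′ x
δ-resp X e = resp (δ X) e (Setoid.refl (Point X))

sol-at : ∀ X Y (f : Point X ⇉ Point Y) {p q x} → graph (δ X) p x →
         graph (Sol X Y f) p q → ∃[ y ] (graph f x y × graph (δ Y) q y)
sol-at X Y f px (x′ , y , px′ , fx′y , qy) =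
  y , resp f (δ-single X px′ px) (Setoid.refl (Point Y)) fx′y , qy

dom⇒sol : ∀ X Y (f : Point X ⇉ Point Y) {p x} → graph (δ X) p x → x ∈dom f →
          p ∈dom Sol X Y f
dom⇒sol X Y f px (y , fxy) = let (q , qy) = δ-onto Y y in q , _ , y , px , fxy , qy

sol⇒∘δ : ∀ X Y (f : Point X ⇉ Point Y) {p x y} → graph (δ X) p x → graph f x y →
         graph (f ∘ δ X) p y
sol⇒∘δ X Y f px fxy =
    (λ x′ px′ → _ , resp f (δ-single X px px′) (Setoid.refl (Point Y)) fxy)
  , _ , px , fxy

∘δ⇒dom : ∀ X Y (f : Point X ⇉ Point Y) {p} → p ∈dom (f ∘ δ X) → p ∈dom Sol X Y f
∘δ⇒dom X Y f (y , _ , x , px , fxy) = dom⇒sol X Y f px (y , fxy)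

realizer⇒sol : ∀ X Y (f : Point X ⇉ Point Y) {G} → Realizes X Y G f →
               ∀ p → p ∈dom Sol X Y f → ∃[ q ] (graph G p q × graph (Sol X Y f) p q)
realizer⇒sol X Y f (_ , real) p (_ , _ , _ , px , fxy , _) =
  let (y , (_ , q , Gpq , qy) , (_ , x , px , fxy)) = real p (_ , sol⇒∘δ X Y f px fxy)
  in q , Gpq , x , y , px , fxy , qy

sol⇒realizer : ∀ X Y (f : Point X ⇉ Point Y) {G} → SingleValued G →
               (∀ p → p ∈dom Sol X Y f → ∃[ q ] (graph G p q × graph (Sol X Y f) p q)) →
               Realizes X Y G f
sol⇒realizer X Y f G-single sel = G-single , λ p p∈ →
  let (q , Gpq , x , y , px , fxy , qy) = sel p (∘δ⇒dom X Y f p∈)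
  in y
   , ((λ q′ Gpq′ → y , δ-resp Y (G-single Gpq Gpq′) qy) , q , Gpq , qy)
   , sol⇒∘δ X Y f px fxy

-- Restricting a choice function to B makes all of its values lie in B.

realizer-within : ChoiceBaire → ∀ X Y (f : Point X ⇉ Point Y) (B : 𝔹 ⇉ 𝔹) →
  (∀ p q → graph B p q → graph (Sol X Y f) p q) →
  (∀ p → p ∈dom Sol X Y f → p ∈dom B) →
  Σ[ G ∈ 𝔹 ⇉ 𝔹 ] (Realizes X Y G f × (∀ p q → graph G p q → graph B p q))
realizer-within choice X Y f B B⊆ dom⊆ =
  let (F , F-single , sel) = choice B
      G : 𝔹 ⇉ 𝔹
      G = record
        { graph = λ p q → graph F p q × graph B p q
        ; resp  = λ { e d (Fpq , Bpq) → resp F e d Fpq , resp B e d Bpq }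
        }
  in G
   , sol⇒realizer X Y f {G} (λ { (Fpq , _) (Fpq′ , _) → F-single Fpq Fpq′ })
       (λ p p∈ → let (q , Fpq , Bpq) = sel p (dom⊆ p p∈)
                 in q , (Fpq , Bpq) , B⊆ p q Bpq)
   , λ { p q (_ , Bpq) → Bpq }

-- Each solution is the value of some realizer at the given instance.

realizer-through : ExcludedMiddle 0ℓ → ChoiceBaire →
  ∀ X Y (f : Point X ⇉ Point Y) {q b} → graph (Sol X Y f) q b →
  Σ[ G ∈ 𝔹 ⇉ 𝔹 ] (Realizes X Y G f × (∀ {q′ b′} → q′ ≗ q → graph G q′ b′ → b′ ≗ b))
realizer-through em choice X Y f {q} {b} fqb =
  let (G , G⊢f , G⊆) = realizer-within choice X Y f B (λ _ _ → proj₁) B-total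
  in G , G⊢f , λ e Gq′b′ → proj₂ (G⊆ _ _ Gq′b′) e
  where
  -- Solutions of f that agree with b at the instance q.
  B : 𝔹 ⇉ 𝔹
  B = record
    { graph = λ p r → graph (Sol X Y f) p r × (p ≗ q → r ≗ b)
    ; resp  = λ { e d (s , at) → resp (Sol X Y f) e d s
                , λ e′ n → trans (sym (d n)) (at (λ k → trans (e k) (e′ k)) n) }
    }

  B-total : ∀ p → p ∈dom Sol X Y f → p ∈dom B
  B-total p (r , s) with em {P = p ≗ q}
  ... | yes e = b , resp (Sol X Y f) (λ n → sym (e n)) (λ _ → refl) fqb , λ _ _ → refl
  ... | no ¬e = r , s , λ e → contradiction e ¬e

-- Weihrauch reducibility without realizers: K has to work for each solution
-- of the instance computed by H.

Reduction : (U V X Y : RepSpace) → (Point U ⇉ Point V) → (Point X ⇉ Point Y) → Set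
Reduction U V X Y f g = ∃[ K ] ∃[ H ] (∀ p → p ∈dom Sol U V f →
  ∃[ q ] (graph ⟦ H ⟧ p q × q ∈dom Sol X Y g ×
    (∀ b → graph (Sol X Y g) q b →
      ∃[ r ] (graph ⟦ K ⟧ ⟨ p , b ⟩ r × graph (Sol U V f) p r))))

reduction⇒≤W : ∀ U V X Y (f : Point U ⇉ Point V) (g : Point X ⇉ Point Y) →
               Reduction U V X Y f g → prob U V f ≤W prob X Y g
reduction⇒≤W U V X Y f g (K , H , red) =
  ⟦ K ⟧ , ⟦ H ⟧ , (K , λ _ _ r → r) , (H , λ _ _ r → r) , λ G G⊢g →
  let
    G-single : SingleValued G
    G-single = proj₁ G⊢g
    GH-single : ∀ {p p′ b b′} → p ≗ p′ →
                graph (G ∘ ⟦ H ⟧) p b → graph (G ∘ ⟦ H ⟧) p′ b′ → b ≗ b′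
    GH-single e (_ , q , Hpq , Gqb) (_ , q′ , Hpq′ , Gqb′) =
      G-single (resp G (⟦⟧-det H e Hpq Hpq′) (λ _ → refl) Gqb) Gqb′
    inner-single : SingleValued ⟪ idₘ , G ∘ ⟦ H ⟧ ⟫
    inner-single = λ { (a , b , p≗a , GHpb , w≗) (a′ , b′ , p≗a′ , GHpb′ , w′≗) n →
      trans (w≗ n) (trans
        (⟨⟩-cong (λ k → trans (sym (p≗a k)) (p≗a′ k)) (GH-single (λ _ → refl) GHpb GHpb′) n)
        (sym (w′≗ n))) }
  in sol⇒realizer U V f {⟦ K ⟧ ∘ ⟪ idₘ , G ∘ ⟦ H ⟧ ⟫}
       (λ { (_ , w , Iw , Kwr) (_ , w′ , Iw′ , Kwr′) →
            ⟦⟧-det K (inner-single Iw Iw′) Kwr Kwr′ })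
       λ p p∈ →
         let (q , Hpq , q∈ , solve) = red p p∈
             (b , Gqb , gqb) = realizer⇒sol X Y g {G} G⊢g q q∈
             (r , Kr , fpr) = solve b gqb
             GHpb : graph (G ∘ ⟦ H ⟧) p b
             GHpb = (λ q′ Hpq′ → b , resp G (⟦⟧-det H (λ _ → refl) Hpq Hpq′) (λ _ → refl) Gqb)
                  , q , Hpq , Gqb
             Iw : graph ⟪ idₘ , G ∘ ⟦ H ⟧ ⟫ p ⟨ p , b ⟩
             Iw = p , b , (λ _ → refl) , GHpb , (λ _ → refl)
         in r
          , ( (λ w′ Iw′ → r , ⟦⟧-resp K (inner-single Iw Iw′) Kr)
            , ⟨ p , b ⟩ , Iw , Kr)
          , fpr

≤W⇒reduction : ExcludedMiddle 0ℓ → ChoiceBaire →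
               ∀ U V X Y (f : Point U ⇉ Point V) (g : Point X ⇉ Point Y) →
               prob U V f ≤W prob X Y g → Reduction U V X Y f g
≤W⇒reduction em choice U V X Y f g (K , H , (cK , K⊆) , (cH , H⊆) , real) =
  cK , cH , λ p p∈ →
  let
    -- What a realizer G of g does along the reduction at p.
    trace : ∀ G → Realizes X Y G g → ∃[ q ] ∃[ b ] ∃[ r ]
      (graph H p q × graph G q b × graph K ⟨ p , b ⟩ r × graph (Sol U V f) p r)
    trace G G⊢g =
      let (r , (_ , w , (a , b , p≗a , (_ , q , Hpq , Gqb) , w≗) , Kwr) , fpr)
            = realizer⇒sol U V f {K ∘ ⟪ idₘ , G ∘ H ⟫} (real G G⊢g) p p∈
      in q , b , r , Hpq , Gqb
       , resp K (λ n → trans (w≗ n) (⟨⟩-cong {q = b} (λ k → sym (p≗a k)) (λ _ → refl) n))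
           (λ _ → refl) Kwr
       , fpr
    (G₀ , G₀⊢g , G₀⊆) =
      realizer-within choice X Y g (Sol X Y g) (λ _ _ s → s) (λ _ s → s)
    (q , b₀ , _ , Hpq , G₀qb₀ , _) = trace G₀ G₀⊢g
  in q , H⊆ p q Hpq , (b₀ , G₀⊆ q b₀ G₀qb₀) , λ b gqb →
  let
    (G₁ , G₁⊢g , G₁≗b) = realizer-through em choice X Y g gqb
    (q₁ , b₁ , r , Hpq₁ , G₁q₁b₁ , Kr , fpr) = trace G₁ G₁⊢g
    q₁≗q = ⟦⟧-det cH (λ _ → refl) (H⊆ p q₁ Hpq₁) (H⊆ p q Hpq)
    b₁≗b = G₁≗b q₁≗q G₁q₁b₁
  in r , ⟦⟧-resp cK (⟨⟩-cong {p} (λ _ → refl) b₁≗b) (K⊆ _ _ Kr) , fpr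

≤W-refl : ∀ h → h ≤W h
≤W-refl ∞            = tt
≤W-refl (prob X Y f) = reduction⇒≤W X Y X Y f f
  (odds , oracle , λ p p∈ → p , oracle-runs p , p∈ , λ b s → b , odds-runs p b , s)

module _ (𝒰 : Machine) where

  -- Evaluation of strongly continuous functions

  -- The index p handles the point x when 𝒰 takes each name of x, paired
  -- with an arbitrary second component, to a name in Y.

  Handles : (X Y : RepSpace) → Baire → Carrier (Point X) → Set
  Handles X Y p x = ∀ q z → graph (δ X) q x →
    ∃[ r ] ∃[ y ] (graph ⟦ 𝒰 ⟧ ⟨ p , ⟨ q , z ⟩ ⟩ r × graph (δ Y) r y)

  handles⇒Φʳ : ∀ X Y {p x q z r y} → Handles X Y p x → graph (δ X) q x →
               graph ⟦ 𝒰 ⟧ ⟨ p , ⟨ q , z ⟩ ⟩ r → graph (δ Y) r y →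
               graph (Φʳ 𝒰 X Y p) x y
  handles⇒Φʳ X Y {p} {x} {q} {z} {r} {y} handles qx run ry =
      (λ { r′ (_ , t , (q′ , z′ , t≗ , q′x) , run′) →
           let (s , w , run″ , sw) = handles q′ z′ q′x
           in w , δ-resp Y (⟦⟧-det 𝒰 (⟨⟩-cong {p} (λ _ → refl) (λ n → sym (t≗ n))) run″ run′) sw })
    , r
    , ( (λ { t (q′ , z′ , t≗ , q′x) →
             let (s , w , run″ , sw) = handles q′ z′ q′x
             in s , ⟦⟧-resp 𝒰 (⟨⟩-cong {p} (λ _ → refl) (λ n → sym (t≗ n))) run″ })
      , ⟨ q , z ⟩ , (q , z , (λ _ → refl) , qx) , run )
    , ry

  handles⇒dom : ∀ X Y {p x} → Handles X Y p x → x ∈dom Φʳ 𝒰 X Y p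
  handles⇒dom X Y {x = x} handles =
    let (q , qx) = δ-onto X x
        (r , y , run , ry) = handles q q qx
    in y , handles⇒Φʳ X Y handles qx run ry

  dom⇒handles : ∀ X Y {p x} → x ∈dom Φʳ 𝒰 X Y p → Handles X Y p x
  dom⇒handles X Y (_ , total , _ , (total′ , _) , _) q z qx =
    let cyl = q , z , (λ _ → refl) , qx
        (r , run) = total′ ⟨ q , z ⟩ cyl
        (y , ry) = total r (total′ , ⟨ q , z ⟩ , cyl , run)
    in r , y , run , ry

  Φʳ⇒run : ∀ X Y {p x y} → graph (Φʳ 𝒰 X Y p) x y → ∃[ q ] ∃[ z ] ∃[ r ]
    (graph (δ X) q x × graph ⟦ 𝒰 ⟧ ⟨ p , ⟨ q , z ⟩ ⟩ r × graph (δ Y) r y)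
  Φʳ⇒run X Y {p} (_ , r , (_ , t , (q , z , t≗ , qx) , run) , ry) =
    q , z , r , qx , ⟦⟧-resp 𝒰 (⟨⟩-cong {p} (λ _ → refl) t≗) run , ry

  -- The compositional product g ⋆ h of two problems, without ∞.

  star : (X Y A B : RepSpace) → (Point X ⇉ Point Y) → (Point A ⇉ Point B) →
         (Point (𝓜 𝒰 B (𝔹ʳ ×ʳ X) ×ʳ A) ⇉ Point (𝔹ʳ ×ʳ Y))
  star X Y A B g h = (idₘ {S = 𝔹} ⊗ g) ∘ transpose 𝒰 A B (𝔹ʳ ×ʳ X) h

  ⋆-instance : ∀ X Y A B (g : Point X ⇉ Point Y) (h : Point A ⇉ Point B) {k} →
               k ∈dom star X Y A B g h → ∃[ x ] (x ∈dom g)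
  ⋆-instance X Y A B g h (_ , _ , (_ , x) , _ , (_ , gxy)) = x , _ , gxy

  module _ (universal : Universal 𝒰) where

    -- The implication belongs to the set

    -- For v ∈ f u and x ∈ dom g, the function with constant value v
    -- together with x is a solution of the implication at u.

    implies-dom : ∀ X Y U V (g : Point X ⇉ Point Y) (f : Point U ⇉ Point V) {x u} →
                  x ∈dom g → u ∈dom f → u ∈dom implies 𝒰 X Y U V g f
    implies-dom X Y U V g f {x} {u} (y , gxy) (v , fuv) =
      let (pv , pvv) = δ-onto V v
          (_ , index) = universal evens
          (c , _ , simulates) = index pv
          run : ∀ q → graph ⟦ 𝒰 ⟧ ⟨ c , q ⟩ pv
          run q = Equivalence.from (simulates q pv) (evens-runs pv q)
          handles : ∀ y → Handles Y V c y
          handles y q z _ = pv , v , run ⟨ q , z ⟩ , pvv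
      in (c , x) , (v , fuv)
       , ( proj₁ (handles⇒dom Y V (handles y))
         , (λ y′ _ → handles⇒dom Y V (handles y′))
         , y , gxy , proj₂ (handles⇒dom Y V (handles y)) )
       , λ { v′ (_ , y′ , _ , cy′v′) →
             let (q , z , r , _ , run′ , rv′) = Φʳ⇒run Y V cy′v′
             in resp f (Setoid.refl (Point U))
                  (δ-single V pvv
                    (δ-resp V (⟦⟧-det 𝒰 (λ _ → refl) run′ (run ⟨ q , z ⟩)) rv′))
                  fuv }

    implication-member : ∀ X Y U V (g : Point X ⇉ Point Y) (f : Point U ⇉ Point V) →
      (∃[ x ] (x ∈dom g)) ⊎ (∀ u → ¬ (u ∈dom f)) →
      prob U V f ≤W _⋆_ 𝒰 (prob X Y g) (prob U (𝓜 𝒰 Y V ×ʳ X) (implies 𝒰 X Y U V g f))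
    implication-member X Y U V g f cases =
      reduction⇒≤W U V (𝓜 𝒰 I (𝔹ʳ ×ʳ X) ×ʳ U) (𝔹ʳ ×ʳ Y) f S (K , pairing s oracle , reduce)
      where
      I : RepSpace
      I = 𝓜 𝒰 Y V ×ʳ X

      i : Point U ⇉ Point I
      i = implies 𝒰 X Y U V g f

      S = star X Y U I g i

      -- ⟨ p , ⟨ a , c ⟩ ⟩ ↦ a.  On a name a = ⟨ b , d ⟩ of (H , x) the
      -- result, read as a name in 𝔹 × X, stands for the pair of b and x.
      -- The parameter p is irrelevant.
      forget : Machine
      forget = evens [ odds ]

      s : Machine
      s = proj₁ (universal forget)

      -- ⟨ p , ⟨ a , q ⟩ ⟩ ↦ 𝒰 ⟨ a , ⟨ q , q ⟩ ⟩.  The second q only fills the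
      -- arbitrary second component of a name under δcyl.
      K : Machine
      K = 𝒰 [ pairing (evens [ odds ]) (pairing (odds [ odds ]) (odds [ odds ])) ]

      module _ (p : Baire) where

        k : Baire
        k = proj₁ (proj₂ (universal forget) p)

        s-runs : graph ⟦ s ⟧ p k
        s-runs = proj₁ (proj₂ (proj₂ (universal forget) p))

        k-runs : ∀ a c → graph ⟦ 𝒰 ⟧ ⟨ k , ⟨ a , c ⟩ ⟩ a
        k-runs a c = Equivalence.from (proj₂ (proj₂ (proj₂ (universal forget) p)) ⟨ a , c ⟩ a)
          ([]-runs evens odds (odds-runs p ⟨ a , c ⟩) (evens-runs a c))

        k-handles : ∀ Hx → Handles I (𝔹ʳ ×ʳ X) k Hx
        k-handles (H , x) a c (b , d , a≗ , bH , dx) =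
          a , (b , x) , k-runs a c , b , d , a≗ , (λ _ → refl) , dx

        k-value : ∀ {H x b x′} → graph (Φʳ 𝒰 I (𝔹ʳ ×ʳ X) k) (H , x) (b , x′) →
                  Φʳ 𝒰 Y V b ≐ Φʳ 𝒰 Y V H × Setoid._≈_ (Point X) x x′
        k-value {H} {x} {b} {x′} kHx =
          let (a , c , r , (b₁ , d₁ , a≗ , b₁H , d₁x) , run , (b₂ , d₂ , r≗ , b₂≗b , d₂x′))
                = Φʳ⇒run I (𝔹ʳ ×ʳ X) kHx
              e : ⟨ b₁ , d₁ ⟩ ≗ ⟨ b₂ , d₂ ⟩
              e n = trans (sym (a≗ n)) (trans (⟦⟧-det 𝒰 (λ _ → refl) (k-runs a c) run n) (r≗ n))
              b₁≗b : b₁ ≗ b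
              b₁≗b n = trans (⟨⟩-injectiveˡ b₁ b₂ d₁ d₂ e n) (b₂≗b n)
          in resp (δ (𝓜 𝒰 Y V)) b₁≗b (Setoid.refl (Point (𝓜 𝒰 Y V)) {H}) b₁H
           , δ-single X d₁x (δ-resp X (λ n → sym (⟨⟩-injectiveʳ b₁ b₂ d₁ d₂ e n)) d₂x′)

        k-name : ∀ {u} → graph (δ U) p u →
                 graph (δ (𝓜 𝒰 I (𝔹ʳ ×ʳ X) ×ʳ U)) ⟨ k , p ⟩ (k , u)
        k-name pu = k , p , (λ _ → refl) , Setoid.refl (Point (𝓜 𝒰 I (𝔹ʳ ×ʳ X))) {k} , pu

        S-dom : ∀ {u} → u ∈dom i → (k , u) ∈dom S
        S-dom {u} ((H , x) , iu@(_ , (_ , _ , y , gxy , _) , _)) =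
          let (pHx , pHx∈) = δ-onto I (H , x)
              (b , _) = pHx∈
          in (b , y)
           , (λ { (b′ , x′) (_ , (H′ , x″) , (_ , (_ , _ , y′ , gx″y′ , _) , _) , kHx) →
                  (b′ , y′) , (λ _ → refl)
                , resp g (proj₂ (k-value kHx)) (Setoid.refl (Point Y)) gx″y′ })
           , (b , x)
           , ( (λ Hx _ → handles⇒dom I (𝔹ʳ ×ʳ X) (k-handles Hx))
             , (H , x) , iu
             , handles⇒Φʳ I (𝔹ʳ ×ʳ X) {z = pHx} (k-handles (H , x)) pHx∈ (k-runs pHx pHx)
                 (proj₂ (proj₂ (proj₂ (k-handles (H , x) pHx pHx pHx∈)))) )
           , (λ _ → refl) , gxy

        solve : ∀ {u} → graph (δ U) p u → ∀ c →
                graph (Sol (𝓜 𝒰 I (𝔹ʳ ×ʳ X) ×ʳ U) (𝔹ʳ ×ʳ Y) S) ⟨ k , p ⟩ c →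
                ∃[ r ] (graph ⟦ K ⟧ ⟨ p , c ⟩ r × graph (Sol U V f) p r)
        solve {u} pu c sol =
          let ((b , y) , Skuby , (b′ , q , c≗ , b′≗b , qy))
                = sol-at (𝓜 𝒰 I (𝔹ʳ ×ʳ X) ×ʳ U) (𝔹ʳ ×ʳ Y) S (k-name pu) sol
              (_ , (b″ , x′) , (_ , (H , x) , (_ , (_ , totalH , _) , sub) , kHx) , (b″≗b , gx′y))
                = Skuby
              (b″≐H , x≈x′) = k-value kHx
              gxy = resp g (Setoid.sym (Point X) x≈x′) (Setoid.refl (Point Y)) gx′y
              (v₀ , Hyv₀) = totalH y gxy
              b″≗b′ : b″ ≗ b′
              b″≗b′ n = trans (b″≗b n) (sym (b′≗b n))
              toH : ∀ v → graph (Φʳ 𝒰 Y V b′) y v → graph (Φʳ 𝒰 Y V H) y v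
              toH v b′yv = Equivalence.to (b″≐H y v)
                (Φʳ-mono 𝒰 {Y} {V} (λ n → sym (b″≗b′ n)) y v b′yv)
              handles = dom⇒handles Y V
                (v₀ , Φʳ-mono 𝒰 {Y} {V} b″≗b′ y v₀ (Equivalence.from (b″≐H y v₀) Hyv₀))
              (r , v , run , rv) = handles q q qy
              K-run : graph ⟦ K ⟧ ⟨ p , ⟨ b′ , q ⟩ ⟩ r
              K-run = []-runs 𝒰 _
                (pairing-runs _ _
                  ([]-runs evens odds (odds-runs p ⟨ b′ , q ⟩) (evens-runs b′ q))
                  (pairing-runs _ _
                    ([]-runs odds odds (odds-runs p ⟨ b′ , q ⟩) (odds-runs b′ q))
                    ([]-runs odds odds (odds-runs p ⟨ b′ , q ⟩) (odds-runs b′ q))))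
                run
          in r
           , ⟦⟧-resp K (⟨⟩-cong {p} (λ _ → refl) (λ n → sym (c≗ n))) K-run
           , u , v , pu
           , sub v (totalH , y , gxy , toH v (handles⇒Φʳ Y V handles qy run rv))
           , rv

      i-dom : ∀ {u} → u ∈dom f → u ∈dom i
      i-dom u∈ = [ (λ { (_ , x∈) → implies-dom X Y U V g f x∈ u∈ })
                 , (λ empty → contradiction u∈ (empty _)) ]′ cases

      reduce : ∀ p → p ∈dom Sol U V f → ∃[ q ] (graph ⟦ pairing s oracle ⟧ p q ×
        q ∈dom Sol (𝓜 𝒰 I (𝔹ʳ ×ʳ X) ×ʳ U) (𝔹ʳ ×ʳ Y) S ×
        (∀ b → graph (Sol (𝓜 𝒰 I (𝔹ʳ ×ʳ X) ×ʳ U) (𝔹ʳ ×ʳ Y) S) q b →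
          ∃[ r ] (graph ⟦ K ⟧ ⟨ p , b ⟩ r × graph (Sol U V f) p r)))
      reduce p (_ , u , v , pu , fuv , _) =
          ⟨ k p , p ⟩
        , pairing-runs s oracle (s-runs p) (oracle-runs p)
        , dom⇒sol (𝓜 𝒰 I (𝔹ʳ ×ʳ X) ×ʳ U) (𝔹ʳ ×ʳ Y) S (k-name p pu) (S-dom p (i-dom (v , fuv)))
        , solve p pu

    -- The implication is a lower bound

    implication-lower : ∀ X Y U V A B (g : Point X ⇉ Point Y) (f : Point U ⇉ Point V)
      (h : Point A ⇉ Point B) →
      Reduction U V (𝓜 𝒰 B (𝔹ʳ ×ʳ X) ×ʳ A) (𝔹ʳ ×ʳ Y) f (star X Y A B g h) →
      Reduction U (𝓜 𝒰 Y V ×ʳ X) A B (implies 𝒰 X Y U V g f) h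
    implication-lower X Y U V A B g f h (K , H , red) = K′ , odds [ H ] , reduce
      where
      i = implies 𝒰 X Y U V g f
      S = star X Y A B g h

      -- ⟨ ⟨ p , r ⟩ , ⟨ q , z ⟩ ⟩ ↦ K ⟨ p , ⟨ r , q ⟩ ⟩
      rearrange M : Machine
      rearrange = pairing (evens [ evens ]) (pairing (odds [ evens ]) (evens [ odds ]))
      M = K [ rearrange ]

      M-runs : ∀ p r q z {t} → graph ⟦ K ⟧ ⟨ p , ⟨ r , q ⟩ ⟩ t →
               graph ⟦ M ⟧ ⟨ ⟨ p , r ⟩ , ⟨ q , z ⟩ ⟩ t
      M-runs p r q z = []-runs K rearrange
        (pairing-runs _ _ ([]-runs evens evens left (evens-runs p r))
          (pairing-runs _ _ ([]-runs odds evens left (odds-runs p r))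
                            ([]-runs evens odds right (evens-runs q z))))
        where
        left  = evens-runs ⟨ p , r ⟩ ⟨ q , z ⟩
        right = odds-runs ⟨ p , r ⟩ ⟨ q , z ⟩

      s : Machine
      s = proj₁ (universal M)

      -- With H p = ⟨ k , a ⟩, the machine W is
      -- ⟨ p , b ⟩ ↦ 𝒰 ⟨ k , ⟨ b , b ⟩ ⟩, and if its result is ⟨ r , x ⟩
      -- then K′ is ⟨ p , b ⟩ ↦ ⟨ s ⟨ p , r ⟩ , x ⟩.
      W K′ : Machine
      W  = 𝒰 [ pairing ((evens [ H ]) [ evens ]) (pairing odds odds) ]
      K′ = pairing (s [ pairing evens (evens [ W ]) ]) (odds [ W ])

      W-runs : ∀ {p b k a w} → graph ⟦ H ⟧ p ⟨ k , a ⟩ →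
               graph ⟦ 𝒰 ⟧ ⟨ k , ⟨ b , b ⟩ ⟩ w → graph ⟦ W ⟧ ⟨ p , b ⟩ w
      W-runs {p} {b} {k} {a} H-run = []-runs 𝒰 _
        (pairing-runs _ _
          ([]-runs (evens [ H ]) evens (evens-runs p b) ([]-runs evens H H-run (evens-runs k a)))
          (pairing-runs _ _ (odds-runs p b) (odds-runs p b)))

      K′-runs : ∀ {p b r x e} → graph ⟦ W ⟧ ⟨ p , b ⟩ ⟨ r , x ⟩ →
                graph ⟦ s ⟧ ⟨ p , r ⟩ e → graph ⟦ K′ ⟧ ⟨ p , b ⟩ ⟨ e , x ⟩
      K′-runs {p} {b} {r} {x} W-run s-run = pairing-runs _ _
        ([]-runs s _ (pairing-runs _ _ (evens-runs p b) ([]-runs evens W W-run (evens-runs r x)))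
          s-run)
        ([]-runs odds W W-run (odds-runs r x))

      reduce : ∀ p → p ∈dom Sol U (𝓜 𝒰 Y V ×ʳ X) i →
        ∃[ q ] (graph ⟦ odds [ H ] ⟧ p q × q ∈dom Sol A B h ×
          (∀ b → graph (Sol A B h) q b →
            ∃[ r ] (graph ⟦ K′ ⟧ ⟨ p , b ⟩ r × graph (Sol U (𝓜 𝒰 Y V ×ʳ X) i) p r)))
      reduce p (_ , u , _ , pu , (u∈ , _) , _) =
        let (q , H-run , (c , sol) , solve) = red p (dom⇒sol U V f pu u∈)
            ((k , a) , _ , (k′ , a′ , q≗ , k′k , a′a) , (total , _ , (hk , b , hab , _) , _) , _)
              = sol
            H-run′ : graph ⟦ H ⟧ p ⟨ k′ , a′ ⟩
            H-run′ = resp ⟦ H ⟧ (λ _ → refl) q≗ H-run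
        in a′
         , []-runs odds H H-run′ (odds-runs k′ a′)
         , dom⇒sol A B h a′a (b , hab)
         , λ pb hpb →
        let (b , hab , pbb) = sol-at A B h a′a hpb
            (rx₀ , kb) = hk b hab
            handles = dom⇒handles B (𝔹ʳ ×ʳ X) (rx₀ , Equivalence.from (k′k b rx₀) kb)
            (w , (r , x) , 𝒰-run , w-name) = handles pb pb pbb
            (r′ , x′ , w≗ , r′≗r , x′x) = w-name
            hka : graph (Φʳ 𝒰 B (𝔹ʳ ×ʳ X) k ∘ h) a (r , x)
            hka = hk , b , hab
                , Equivalence.to (k′k b (r , x)) (handles⇒Φʳ B (𝔹ʳ ×ʳ X) handles pbb 𝒰-run w-name)
            ((_ , y₀) , _ , gxy₀) = total (r , x) hka
            (e , s-run , simulates) = proj₂ (universal M) ⟨ p , r′ ⟩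

            -- Since (r , y) solves S at (k , a) for every y ∈ g x, the
            -- index e takes names of y to names of elements of f u.
            e-runs : ∀ {y} → graph g x y → ∀ qy z → graph (δ Y) qy y → ∃[ t ] ∃[ v ]
              (graph ⟦ 𝒰 ⟧ ⟨ e , ⟨ qy , z ⟩ ⟩ t × graph (δ V) t v × graph f u v)
            e-runs {y} gxy qy z qyy =
              let (t , K-run , ft) = solve ⟨ r′ , qy ⟩
                    ( (k , a) , (r , y) , (k′ , a′ , q≗ , k′k , a′a)
                    , (total , (r , x) , hka , (λ _ → refl) , gxy)
                    , (r′ , qy , (λ _ → refl) , r′≗r , qyy) )
                  (v , fuv , tv) = sol-at U V f pu ft
              in t , v , Equivalence.from (simulates ⟨ qy , z ⟩ t) (M-runs p r′ qy z K-run)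
               , tv , fuv

            e-handles : ∀ {y} → graph g x y → Handles Y V e y
            e-handles gxy qy z qyy =
              let (t , v , run , tv , _) = e-runs gxy qy z qyy in t , v , run , tv

            (v₀ , ey₀v₀) = handles⇒dom Y V (e-handles gxy₀)

            e-correct : ∀ v → graph (Φʳ 𝒰 Y V e ∘ g) x v → graph f u v
            e-correct v (_ , y , gxy , eyv) =
              let (qy , z , t , qyy , run , tv) = Φʳ⇒run Y V eyv
                  (t′ , v′ , run′ , t′v′ , fuv′) = e-runs gxy qy z qyy
              in resp f (Setoid.refl (Point U))
                   (δ-single V t′v′ (δ-resp V (⟦⟧-det 𝒰 (λ _ → refl) run run′) tv)) fuv′
        in ⟨ e , x′ ⟩
         , K′-runs (W-runs H-run′ (resp ⟦ 𝒰 ⟧ (λ _ → refl) w≗ 𝒰-run)) s-run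
         , u , (e , x) , pu
         , ( u∈
           , (v₀ , (λ y gxy → handles⇒dom Y V (e-handles gxy)) , y₀ , gxy₀ , ey₀v₀)
           , e-correct )
         , e , x′ , (λ _ → refl) , Setoid.refl (Point (𝓜 𝒰 Y V)) {e} , x′x

  -- The minimum

  implication-minimum : (em : ExcludedMiddle 0ℓ) → ChoiceBaire → Universal 𝒰 →
    ∀ U V X Y (f : Point U ⇉ Point V) (g : Point X ⇉ Point Y) →
    IsMinimum (λ h → prob U V f ≤W _⋆_ 𝒰 (prob X Y g) h) (implication 𝒰 em X Y U V g f)
  implication-minimum em choice universal U V X Y f g
    with em {P = (∃[ x ] (x ∈dom g)) ⊎ (∀ u → ¬ (u ∈dom f))}
  ... | yes cases = implication-member universal X Y U V g f cases , λ where
    ∞            _    → tt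
    (prob A B h) f≤gh → reduction⇒≤W U (𝓜 𝒰 Y V ×ʳ X) A B (implies 𝒰 X Y U V g f) h
      (implication-lower universal X Y U V A B g f h
        (≤W⇒reduction em choice U V (𝓜 𝒰 B (𝔹ʳ ×ʳ X) ×ʳ A) (𝔹ʳ ×ʳ Y) f (star X Y A B g h) f≤gh))
  ... | no neither = tt , λ where
    ∞            _    → tt
    (prob A B h) f≤gh →
      let (_ , _ , red) = ≤W⇒reduction em choice U V (𝓜 𝒰 B (𝔹ʳ ×ʳ X) ×ʳ A) (𝔹ʳ ×ʳ Y)
                            f (star X Y A B g h) f≤gh
          empty : ∀ u → ¬ (u ∈dom f)
          empty u u∈ =
            let (p , pu) = δ-onto U u
                (_ , _ , (_ , _ , c , _ , Sc , _) , _) = red p (dom⇒sol U V f pu u∈)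
            in neither (inj₁ (⋆-instance X Y A B g h (c , Sc)))
      in contradiction (inj₂ empty) neither

theorem3p13 : (em : ExcludedMiddle 0ℓ) → ChoiceBaire →
    (𝒰 : Machine) → Universal 𝒰 →
    (U V X Y : RepSpace) (f : Point U ⇉ Point V) (g : Point X ⇉ Point Y) →
    ∃[ m ] (IsMinimum (λ h → prob U V f ≤W _⋆_ 𝒰 (prob X Y g) h) m
    × implication 𝒰 em X Y U V g f ≡W m)
theorem3p13 em choice 𝒰 universal U V X Y f g =
    implication 𝒰 em X Y U V g f
  , implication-minimum 𝒰 em choice universal U V X Y f g
  , ≤W-refl _ , ≤W-refl _
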